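{- For any string $S$ over the binary alphabet $\Sigma_2 = \{\mathtt{0},\mathtt{1}\}$ with $|S| = d \ge 1$, $$|\mathsf{MAW}(S) \bigtriangleup \mathsf{MAW}(S\mathtt{0})| \le \max\{3,d\},$$ and this upper bound is tight for any $d \ge 1$: for every $d \ge 1$ there is a string $S$ over $\Sigma_2$ with $|S| = d$ and $|\mathsf{MAW}(S) \bigtriangleup \mathsf{MAW}(S\mathtt{0})| = \max\{3,d\}$.
   Context: A string $w$ occurs in $S$ if it is a (contiguous) substring of $S$; the empty string occurs in every string. A non-empty string $w \in \Sigma_2^*$ is a minimal absent word (MAW) for $S$ if $w$ does not occur in $S$ but every proper substring of $w$ occurs in $S$ (in particular a character of $\Sigma_2$ not occurring in $S$ is a MAW for $S$). $\mathsf{MAW}(S)$ is the set of all MAWs for $S$ relative to the alphabet $\Sigma_2$. $\bigtriangleup$ denotes symmetric difference, and $S\mathtt{0}$ is $S$ with the character $\mathtt{0}$ appended on the right. -}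

module Defs where

open import Data.Fin.Base using (Fin)
open import Data.List.Base using (List; []; length)
open import Data.List.Membership.Propositional using () renaming (_∈_ to _∈ˡ_)
open import Data.List.Relation.Binary.Infix.Heterogeneous using (Infix)
open import Data.List.Relation.Unary.Unique.Propositional using (Unique)
open import Data.Nat.Base using (ℕ)
open import Data.Product.Base using (_×_; ∃-syntax)
open import Level using (Level; 0ℓ; _⊔_)
open import Relation.Binary.PropositionalEquality using (_≡_; _≢_)
open import Relation.Nullary.Negation using (¬_)
open import Relation.Unary using (Pred; _∪_; _∖_; _≐_)

private
  variable
    a ℓ₁ ℓ₂ : Level
    A : Set a

Σ₂ : Set
Σ₂ = Fin 2

String₂ : Set
String₂ = List Σ₂

infix 4 _OccursIn_ _ProperSubstringOf_

_OccursIn_ : String₂ → String₂ → Set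
w OccursIn S = Infix _≡_ w S

_ProperSubstringOf_ : String₂ → String₂ → Set
u ProperSubstringOf w = u OccursIn w × u ≢ w

MAW : String₂ → Pred String₂ 0ℓ
MAW S w =
  w ≢ [] ×
  ¬ (w OccursIn S) ×
  (∀ u → u ProperSubstringOf w → u OccursIn S)

infixr 6 _△_

_△_ : Pred A ℓ₁ → Pred A ℓ₂ → Pred A (ℓ₁ ⊔ ℓ₂)
P △ Q = (P ∖ Q) ∪ (Q ∖ P)

-- Finiteness of P is part of the claim, since xs must list all of P.
HasCardinality : {A : Set a} → Pred A ℓ₁ → ℕ → Set (a ⊔ ℓ₁)
HasCardinality P n = ∃[ xs ] Unique xs × P ≐ (_∈ˡ xs) × length xs ≡ n

{-# OPTIONS --safe #-}

-- Write T = S0. The only word in MAW(S) \ MAW(T) is the shortest suffix v of T absent from S.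
-- A word in MAW(T) \ MAW(S) is either v0, v1, or a u 0 where u is a suffix of S, u0 does not
-- occur in S, au does, and the letter preceding u in S is not a. In the last case au is not a
-- suffix of S, so it extends to an occurrence of au1 in S; hence |u| ≤ |S| − 2, with equality
-- only for S = 01…1. As u is non-empty and determines a, at most |S| − 3 words of this kind arise
-- in general. For S = 01ᵏ⁺¹ there is one more, but v = 10 and v0 = 100 is not in MAW(T),
-- since 00 does not occur in T. Equality holds for S = 1, 11 and 01ᵏ⁺¹ with k ≥ 1.

module Submission where

open import Defs
open import Data.Fin.Base using (opposite)
open import Data.Fin.Patterns using (0F; 1F)
open import Data.Fin.Properties using () renaming (_≟_ to _≟ᶠ_)
open import Data.List.Base
  using (List; []; _∷_; length; _∷ʳ_; drop; filter; deduplicate; replicate; initLast; _∷ʳ′_)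
open import Data.List.Membership.Propositional using (_∈_)
open import Data.List.Membership.Propositional.Properties
  using (∈-filter⁺; ∈-filter⁻; ∈-deduplicate⁺)
open import Data.List.Properties
  using (≡-dec; length-filter; length-deduplicate; length-replicate;
         ++-identityʳ-unique; ∷-injective; ∷ʳ-injective)
open import Data.List.Relation.Binary.Infix.Heterogeneous using (here; there; _++ⁱ_; _ⁱ++_)
import Data.List.Relation.Binary.Infix.Heterogeneous.Properties as Infix
open import Data.List.Relation.Binary.Pointwise using ([]; _∷_; Pointwise-≡⇒≡; ≡⇒Pointwise-≡)
open import Data.List.Relation.Binary.Prefix.Heterogeneous using (Prefix; []; _∷_)
open import Data.List.Relation.Binary.Suffix.Heterogeneous using (Suffix; here; there; _++ˢ_)
import Data.List.Relation.Binary.Suffix.Heterogeneous.Properties as Suffix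
open import Data.List.Relation.Unary.All as All using (All; []; _∷_)
open import Data.List.Relation.Unary.AllPairs using ([]; _∷_)
open import Data.List.Relation.Unary.Any using (here; there)
open import Data.List.Relation.Unary.Unique.Propositional using (Unique)
open import Data.List.Relation.Unary.Unique.DecPropositional.Properties using (deduplicate-!)
open import Data.List.Relation.Unary.Unique.Propositional.Properties using (filter⁺)
open import Data.Nat.Base using (ℕ; zero; suc; pred; _+_; _∸_; _≤_; _<_; _⊔_; z≤n; s≤s)
open import Data.Nat.Properties
  using (≤-refl; ≤-trans; ≤-reflexive; <-irrefl; <⇒≢; m≤n⊔m; n≤1+n; m≤n⇒m<n∨m≡n;
         module ≤-Reasoning)
open import Data.Product.Base using (_×_; _,_; proj₁; proj₂; ∃-syntax)
open import Data.Sum.Base as Sum using (_⊎_; inj₁; inj₂; [_,_]′)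
open import Function.Base using (_∘_; id)
open import Relation.Binary.PropositionalEquality
  using (_≡_; _≢_; refl; sym; trans; cong; subst)
open import Relation.Nullary.Decidable using (Dec; yes; no; map′; _×-dec_; _⊎-dec_; ¬?; toWitness)
open import Relation.Nullary.Negation using (¬_; contradiction)
open import Relation.Unary using (Decidable; _⊆_)

-- Occurrences, prefixes and suffixes when a letter is appended

_SuffixOf_ : String₂ → String₂ → Set
w SuffixOf S = Suffix _≡_ w S

infix 4 _SuffixOf_

private
  variable
    S T u v w : String₂
    a b c : Σ₂

length-∷ʳ : ∀ {A : Set} (xs : List A) x → length (xs ∷ʳ x) ≡ suc (length xs)
length-∷ʳ []       x = refl
length-∷ʳ (_ ∷ xs) x = cong suc (length-∷ʳ xs x)

occurs-refl : w OccursIn w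
occurs-refl = Infix.fromPointwise (≡⇒Pointwise-≡ refl)

occurs-trans : u OccursIn v → v OccursIn w → u OccursIn w
occurs-trans = Infix.trans trans

occurs? : ∀ w S → Dec (w OccursIn S)
occurs? = Infix.infix? _≟ᶠ_

occurs-length-≡ : u OccursIn v → length u ≡ length v → u ≡ v
occurs-length-≡ (here p) eq = prefix p eq
  where
  prefix : ∀ {u v : String₂} → Prefix _≡_ u v → length u ≡ length v → u ≡ v
  prefix {v = []}    []         eq = refl
  prefix (refl ∷ p) eq = cong (_ ∷_) (prefix p (cong pred eq))
occurs-length-≡ (there p) eq = contradiction eq (<⇒≢ (s≤s (Infix.length-mono p)))

prefix-∷ʳ : ∀ S → Prefix _≡_ w (S ∷ʳ c) → Prefix _≡_ w S ⊎ w ≡ S ∷ʳ c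
prefix-∷ʳ []      []          = inj₁ []
prefix-∷ʳ []      (refl ∷ []) = inj₂ refl
prefix-∷ʳ (x ∷ S) []          = inj₁ []
prefix-∷ʳ (x ∷ S) (refl ∷ p) = Sum.map (refl ∷_) (cong (x ∷_)) (prefix-∷ʳ S p)

occurs-∷ʳ : ∀ S → w OccursIn (S ∷ʳ c) → w OccursIn S ⊎ w SuffixOf (S ∷ʳ c)
occurs-∷ʳ []      (here p)  = Sum.map here (here ∘ ≡⇒Pointwise-≡) (prefix-∷ʳ [] p)
occurs-∷ʳ []      (there p) = inj₁ p
occurs-∷ʳ (x ∷ S) (here p)  = Sum.map here (here ∘ ≡⇒Pointwise-≡) (prefix-∷ʳ (x ∷ S) p)
occurs-∷ʳ (x ∷ S) (there p) = Sum.map there there (occurs-∷ʳ S p)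

prefix-init : ∀ u S → Prefix _≡_ (u ∷ʳ b) (S ∷ʳ c) → Prefix _≡_ u S
prefix-init []          S       p          = []
prefix-init (_ ∷ [])    []      (_ ∷ ())
prefix-init (_ ∷ _ ∷ _) []      (_ ∷ ())
prefix-init (_ ∷ u)     (_ ∷ S) (refl ∷ p) = refl ∷ prefix-init u S p

-- The occurrence ends no later than the last letter of `S ∷ʳ c`, so dropping its own last letter
-- leaves an occurrence inside `S`.
occurs-init : ∀ u S → (u ∷ʳ b) OccursIn (S ∷ʳ c) → u OccursIn S
occurs-init []          S       p                = here []
occurs-init (_ ∷ [])    []      (here (_ ∷ ()))
occurs-init (_ ∷ _ ∷ _) []      (here (_ ∷ ()))
occurs-init (_ ∷ _)     []      (there (here ()))
occurs-init u@(_ ∷ _)   (x ∷ S) (here p)         = here (prefix-init u (x ∷ S) p)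
occurs-init u@(_ ∷ _)   (x ∷ S) (there p)        = there (occurs-init u S p)

occurs-extend : w OccursIn S → w SuffixOf S ⊎ ∃[ b ] (w ∷ʳ b) OccursIn S
occurs-extend (here p) = Sum.map (here ∘ ≡⇒Pointwise-≡) (λ (b , q) → b , here q) (prefix p)
  where
  prefix : ∀ {w S : String₂} → Prefix _≡_ w S → w ≡ S ⊎ ∃[ b ] Prefix _≡_ (w ∷ʳ b) S
  prefix {S = []}    []         = inj₁ refl
  prefix {S = x ∷ S} []         = inj₂ (x , refl ∷ [])
  prefix             (refl ∷ p) = Sum.map (cong (_ ∷_)) (λ (b , q) → b , refl ∷ q) (prefix p)
occurs-extend (there p) = Sum.map there (λ (b , q) → b , there q) (occurs-extend p)

suffix-∷ʳ⁺ : u SuffixOf S → (u ∷ʳ c) SuffixOf (S ∷ʳ c)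
suffix-∷ʳ⁺ (here p)  = here (≡⇒Pointwise-≡ (cong (_∷ʳ _) (Pointwise-≡⇒≡ p)))
suffix-∷ʳ⁺ (there p) = there (suffix-∷ʳ⁺ p)

suffix-∷ʳ⁻ : ∀ u S → (u ∷ʳ b) SuffixOf (S ∷ʳ c) → u SuffixOf S × b ≡ c
suffix-∷ʳ⁻ []      []      (here (eq ∷ [])) = here [] , eq
suffix-∷ʳ⁻ []      []      (there (here ()))
suffix-∷ʳ⁻ (_ ∷ [])    []  (here (_ ∷ ()))
suffix-∷ʳ⁻ (_ ∷ _ ∷ _) []  (here (_ ∷ ()))
suffix-∷ʳ⁻ (_ ∷ _) []      (there (here ()))
suffix-∷ʳ⁻ u       (x ∷ S) (here p)
  with refl , eq ← ∷ʳ-injective u (x ∷ S) (Pointwise-≡⇒≡ p) = here (≡⇒Pointwise-≡ refl) , eq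
suffix-∷ʳ⁻ u       (_ ∷ S) (there p) with q , eq ← suffix-∷ʳ⁻ u S p = there q , eq

suffix-comparable : u SuffixOf T → v SuffixOf T → u SuffixOf v ⊎ v SuffixOf u
suffix-comparable (here p)  q with refl ← Pointwise-≡⇒≡ p = inj₂ q
suffix-comparable (there p) (here q) with refl ← Pointwise-≡⇒≡ q = inj₁ (there p)
suffix-comparable (there p) (there q) = suffix-comparable p q

suffix-drop1 : v SuffixOf w → v ≡ w ⊎ v SuffixOf drop 1 w
suffix-drop1 (here p)  = inj₁ (Pointwise-≡⇒≡ p)
suffix-drop1 (there p) = inj₂ p

shorter-suffix-drop1 : u SuffixOf S → length u < length S → u SuffixOf drop 1 S
shorter-suffix-drop1 p lt with suffix-drop1 p
... | inj₁ refl = contradiction lt (<-irrefl refl)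
... | inj₂ q    = q

-- Minimal absent words through their two longest proper substrings

tail-proper : v ProperSubstringOf (c ∷ v)
tail-proper = there occurs-refl , λ eq → <-irrefl (cong length eq) ≤-refl

init-proper : ∀ u → u ProperSubstringOf (u ∷ʳ b)
init-proper u = occurs-refl ⁱ++ _ , λ eq → contradiction (++-identityʳ-unique u eq) λ ()

MAW-singleton : ¬ (a ∷ []) OccursIn S → MAW S (a ∷ [])
MAW-singleton a∉S = (λ ()) , a∉S , λ where
  _ (here []          , _) → here []
  _ (here (refl ∷ []) , ≢) → contradiction refl ≢
  _ (there (here [])  , _) → here []

-- Only two substrings need checking: a proper substring that starts at the first letter lies in
-- `a ∷ u`, and any other lies in `u ∷ʳ b`. Together with `MAW⁻` this makes `MAW` decidable.
MAW⁺ : ∀ u → ¬ (a ∷ u ∷ʳ b) OccursIn S → (a ∷ u) OccursIn S → (u ∷ʳ b) OccursIn S →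
       MAW S (a ∷ u ∷ʳ b)
MAW⁺ {a} u w∉S au ub = (λ ()) , w∉S , λ where
  _ (here p  , ≢) → [ (λ q → occurs-trans (here q) au) , (λ eq → contradiction eq ≢) ]′
                      (prefix-∷ʳ (a ∷ u) p)
  _ (there p , _) → occurs-trans p ub

MAW⁻ : ∀ u → MAW S (a ∷ u ∷ʳ b) →
       ¬ (a ∷ u ∷ʳ b) OccursIn S × (a ∷ u) OccursIn S × (u ∷ʳ b) OccursIn S
MAW⁻ u (_ , w∉S , sub) = w∉S , sub _ (init-proper (_ ∷ u)) , sub _ tail-proper

MAW? : ∀ S → Decidable (MAW S)
MAW? S []      = no λ (≢[] , _) → ≢[] refl
MAW? S (a ∷ v) with initLast v
... | []       = map′ MAW-singleton (proj₁ ∘ proj₂) (¬? (occurs? _ S))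
... | u ∷ʳ′ b  = map′ (λ (p , q , r) → MAW⁺ u p q r) (MAW⁻ u)
                   (¬? (occurs? _ S) ×-dec occurs? _ S ×-dec occurs? _ S)

△? : ∀ S T → Decidable (MAW S △ MAW T)
△? S T w = (MAW? S w ×-dec ¬? (MAW? T w)) ⊎-dec (MAW? T w ×-dec ¬? (MAW? S w))

-- Shortest absent suffix and flipped suffixes

-- Minimality is required of the next shorter suffix only, since all shorter ones are substrings of
-- it.
ShortestAbsentSuffix : String₂ → String₂ → Set
ShortestAbsentSuffix S w = w SuffixOf (S ∷ʳ 0F) × ¬ w OccursIn S × drop 1 w OccursIn S

-- The search starts from S0, absent because it is longer than S, and strips letters from the left
-- until the rest occurs. It stops because the empty word occurs in S.
∃-shortestAbsentSuffix : ∀ S → ∃[ w ] ShortestAbsentSuffix S w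
∃-shortestAbsentSuffix S = search (here (≡⇒Pointwise-≡ refl)) T∉S
  where
  T∉S : ¬ (S ∷ʳ 0F) OccursIn S
  T∉S p = <-irrefl refl (subst (_≤ length S) (length-∷ʳ S 0F) (Infix.length-mono p))

  search : u SuffixOf (S ∷ʳ 0F) → ¬ u OccursIn S → ∃[ w ] ShortestAbsentSuffix S w
  search {u = []}    p u∉S = contradiction (here []) u∉S
  search {u = c ∷ v} p u∉S with occurs? v S
  ... | yes v∈S = c ∷ v , p , u∉S , v∈S
  ... | no  v∉S = search (Suffix.trans trans (there (here (≡⇒Pointwise-≡ refl))) p) v∉S

-- One of the two words is a suffix of the other; if properly so, it lies in the tail of the other
-- and hence occurs in S.
shortestAbsentSuffix-unique : ShortestAbsentSuffix S v → ShortestAbsentSuffix S w → v ≡ w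
shortestAbsentSuffix-unique (p , v∉S , v⁻∈S) (q , w∉S , w⁻∈S) with suffix-comparable p q
... | inj₁ r = [ id , (λ r → contradiction (occurs-trans (Infix.fromSuffix r) w⁻∈S) v∉S) ]′ (suffix-drop1 r)
... | inj₂ r = [ sym , (λ r → contradiction (occurs-trans (Infix.fromSuffix r) v⁻∈S) w∉S) ]′ (suffix-drop1 r)

-- The words x̄ u 0, where x u runs over the suffixes of S with u non-empty.
flippedSuffixes : String₂ → List String₂
flippedSuffixes []          = []
flippedSuffixes (_ ∷ [])    = []
flippedSuffixes (x ∷ y ∷ S) = (opposite x ∷ y ∷ S ∷ʳ 0F) ∷ flippedSuffixes (y ∷ S)

length-flippedSuffixes : ∀ S → length (flippedSuffixes S) ≡ length S ∸ 1
length-flippedSuffixes []          = refl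
length-flippedSuffixes (_ ∷ [])    = refl
length-flippedSuffixes (_ ∷ y ∷ S) = cong suc (length-flippedSuffixes (y ∷ S))

≢⇒≡opposite : ∀ (a x : Σ₂) → a ≢ x → a ≡ opposite x
≢⇒≡opposite 0F 0F ≢ = contradiction refl ≢
≢⇒≡opposite 0F 1F ≢ = refl
≢⇒≡opposite 1F 0F ≢ = refl
≢⇒≡opposite 1F 1F ≢ = contradiction refl ≢

-- Some letter x precedes `u` in S. As `a ∷ u` is not a suffix, x differs from `a`, and over two
-- letters this makes `a` the opposite of x.
∈-flippedSuffixes : u ≢ [] → u SuffixOf drop 1 S → ¬ (a ∷ u) SuffixOf S →
                    (a ∷ u ∷ʳ 0F) ∈ flippedSuffixes S
∈-flippedSuffixes {S = []}        u≢[] (here []) _ = contradiction refl u≢[]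
∈-flippedSuffixes {S = _ ∷ []}    u≢[] (here []) _ = contradiction refl u≢[]
∈-flippedSuffixes {S = x ∷ y ∷ S} {a = a} u≢[] (here p) au∉S with refl ← Pointwise-≡⇒≡ p =
  here (cong (_∷ _) (≢⇒≡opposite a x λ { refl → au∉S (here (≡⇒Pointwise-≡ refl)) }))
∈-flippedSuffixes {S = x ∷ y ∷ S} u≢[] (there p) au∉S =
  there (∈-flippedSuffixes u≢[] p (au∉S ∘ there))

-- Read position by position, the equation makes each letter of `a ∷ u` equal to its successor and
-- the last one equal to `c`.
∷≡∷ʳ⇒replicate : ∀ u → a ∷ u ≡ u ∷ʳ c → a ∷ u ≡ replicate (suc (length u)) c
∷≡∷ʳ⇒replicate []      eq = eq
∷≡∷ʳ⇒replicate (y ∷ u) eq with refl , eq′ ← ∷-injective eq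
  with ih ← ∷≡∷ʳ⇒replicate u eq′
  with refl , _ ← ∷-injective ih = cong (y ∷_) ih

-- This rules out an empty `u` below: without 0 in S, the letter `a` is 1 and so is the last letter
-- of S.
0∉⇒extended-suffix : ¬ (0F ∷ []) OccursIn S → (a ∷ []) OccursIn S → (a ∷ []) SuffixOf S
0∉⇒extended-suffix {S} {0F} 0∉S a∈S = contradiction a∈S 0∉S
0∉⇒extended-suffix {S} {1F} 0∉S a∈S with initLast S
0∉⇒extended-suffix {a = 1F} 0∉S (here ()) | []
... | S′ ∷ʳ′ 0F = contradiction (S′ ++ⁱ occurs-refl) 0∉S
... | S′ ∷ʳ′ 1F = S′ ++ˢ here (refl ∷ [])

ones : ℕ → String₂
ones n = replicate n 1F

first-letter : ∀ a {n} → b ∷ u ≡ ones (suc n) → ¬ (a ∷ u) SuffixOf (a ∷ b ∷ u) → a ≡ 0F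
first-letter 0F eq   ¬s = refl
first-letter 1F refl ¬s = contradiction (there (here (≡⇒Pointwise-≡ refl))) ¬s

-- The generic count uses the shorter list, from `drop 2 S`; for S = 01...1 only the longer one,
-- from `drop 1 S`, is available.
∈-flippedSuffixes-tail :
  u SuffixOf S → ¬ (u ∷ʳ 0F) OccursIn S → (a ∷ u) OccursIn S → ¬ (a ∷ u) SuffixOf S →
  (a ∷ u ∷ʳ 0F) ∈ flippedSuffixes (drop 1 S) ×
  ((a ∷ u ∷ʳ 0F) ∈ flippedSuffixes (drop 2 S) ⊎ ∃[ k ] S ≡ 0F ∷ ones (suc k))
∈-flippedSuffixes-tail {u} {S} {a} u-suffix u0∉S au∈S au-not-suffix = go S u-suffix au1∈S au-not-suffix
  where
  au1∈S : (a ∷ u ∷ʳ 1F) OccursIn S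
  au1∈S with occurs-extend au∈S
  ... | inj₁ q        = contradiction q au-not-suffix
  ... | inj₂ (0F , q) = contradiction (occurs-trans (there occurs-refl) q) u0∉S
  ... | inj₂ (1F , q) = q

  u≢[] : u ≢ []
  u≢[] refl = au-not-suffix (0∉⇒extended-suffix u0∉S au∈S)

  go : ∀ S → u SuffixOf S → (a ∷ u ∷ʳ 1F) OccursIn S → ¬ (a ∷ u) SuffixOf S →
       (a ∷ u ∷ʳ 0F) ∈ flippedSuffixes (drop 1 S) ×
       ((a ∷ u ∷ʳ 0F) ∈ flippedSuffixes (drop 2 S) ⊎ ∃[ k ] S ≡ 0F ∷ ones (suc k))
  -- `a ∷ u ∷ʳ 1F` has |u| + 2 letters, so S begins with two letters and what follows them is at
  -- least as long as `u`.
  go S p q ¬s with subst (λ n → suc n ≤ length S) (length-∷ʳ u 1F) (Infix.length-mono q)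
  go (x ∷ y ∷ S) p q ¬s | s≤s (s≤s |u|≤|S|) =
    ∈-flippedSuffixes u≢[] p₂ (¬s ∘ there) , last-case (m≤n⇒m<n∨m≡n |u|≤|S|)
    where
    p₁ : u SuffixOf y ∷ S
    p₁ = shorter-suffix-drop1 p (s≤s (≤-trans |u|≤|S| (n≤1+n _)))
    p₂ : u SuffixOf S
    p₂ = shorter-suffix-drop1 p₁ (s≤s |u|≤|S|)

    last-case : length u < length S ⊎ length u ≡ length S →
                (a ∷ u ∷ʳ 0F) ∈ flippedSuffixes S ⊎ ∃[ k ] x ∷ y ∷ S ≡ 0F ∷ ones (suc k)
    last-case (inj₁ lt) = inj₁ (∈-flippedSuffixes u≢[] (shorter-suffix-drop1 p₂ lt)
                                 (λ q → ¬s (there (there q))))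
    -- By length, `u` is all of S after x and y, and `a ∷ u ∷ʳ 1F` is the whole string. Hence x = a
    -- and `y ∷ u` equals `u ∷ʳ 1F`, which consists of 1s.
    last-case (inj₂ eq)
      with refl ← occurs-length-≡ (Infix.fromSuffix p₂) eq
      with refl , u1≡yu ← ∷-injective (occurs-length-≡ q (cong suc (trans (length-∷ʳ u 1F) (cong suc eq))))
      with yu≡ones ← ∷≡∷ʳ⇒replicate u (sym u1≡yu)
      with refl ← first-letter a yu≡ones ¬s = inj₂ (length u , cong (0F ∷_) yu≡ones)

-- Classification of the symmetric difference

-- The second alternative keeps `MAW (S ∷ʳ 0F) w` so that 100 can be excluded when S = 01...1.
△-origin : ∀ S → ShortestAbsentSuffix S v → (MAW S △ MAW (S ∷ʳ 0F)) w →
  w ≡ v ⊎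
  (∃[ b ] w ≡ v ∷ʳ b × MAW (S ∷ʳ 0F) w) ⊎
  (w ∈ flippedSuffixes (drop 1 S) ×
   (w ∈ flippedSuffixes (drop 2 S) ⊎ ∃[ k ] S ≡ 0F ∷ ones (suc k)))
△-origin {w = w} S sas (inj₁ ((w≢[] , w∉S , sub) , ¬mawT)) with occurs? w (S ∷ʳ 0F)
... | no w∉T = contradiction (w≢[] , w∉T , λ u p → sub u p ⁱ++ _) ¬mawT
... | yes w∈T with occurs-∷ʳ S w∈T
...   | inj₁ w∈S = contradiction w∈S w∉S
...   | inj₂ w-suffix = inj₁ (shortestAbsentSuffix-unique (w-suffix , w∉S , drop1∈S w w≢[] sub) sas)
  where
  drop1∈S : ∀ w → w ≢ [] → (∀ u → u ProperSubstringOf w → u OccursIn S) → drop 1 w OccursIn S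
  drop1∈S []      w≢[] _   = contradiction refl w≢[]
  drop1∈S (_ ∷ _) _    sub = sub _ tail-proper
△-origin {w = []}    S sas (inj₂ ((w≢[] , _) , _)) = contradiction refl w≢[]
△-origin {w = a ∷ v} S sas (inj₂ (mawT , ¬mawS)) with initLast v
... | [] = contradiction (MAW-singleton λ a∈S → proj₁ (proj₂ mawT) (a∈S ⁱ++ _)) ¬mawS
... | u ∷ʳ′ b with w∉T , au∈T , ub∈T ← MAW⁻ u mawT with occurs? (a ∷ u) S
...   | no au∉S with occurs-∷ʳ S au∈T
...     | inj₁ au∈S = contradiction au∈S au∉S
-- `a ∷ u` is new in S0 while its tail `u` already occurs in S, so `a ∷ u` is the shortest absent
-- suffix.
...     | inj₂ au-suffix
  with refl ← shortestAbsentSuffix-unique sas (au-suffix , au∉S , occurs-init u S ub∈T) =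
  inj₂ (inj₁ (b , refl , mawT))
△-origin {w = a ∷ v} S sas (inj₂ (mawT , ¬mawS)) | u ∷ʳ′ b | yes au∈S with occurs? (u ∷ʳ b) S
... | yes ub∈S = contradiction (MAW⁺ u (λ w∈S → w∉T (w∈S ⁱ++ _)) au∈S ub∈S) ¬mawS
... | no  ub∉S with occurs-∷ʳ S ub∈T
...   | inj₁ ub∈S = contradiction ub∈S ub∉S
-- Here `u ∷ʳ b` is new in S0, so b = 0 and `u` ends S; were `a ∷ u` a suffix of S too, `w` would
-- occur in S0.
...   | inj₂ ub-suffix with u-suffix , refl ← suffix-∷ʳ⁻ u S ub-suffix =
  inj₂ (inj₂ (∈-flippedSuffixes-tail u-suffix ub∉S au∈S (w∉T ∘ Infix.fromSuffix ∘ suffix-∷ʳ⁺)))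

candidates : String₂ → String₂ → List String₂
candidates S v = v ∷ (v ∷ʳ 0F) ∷ (v ∷ʳ 1F) ∷ flippedSuffixes (drop 2 S)

△⊆candidates : ∀ S → ShortestAbsentSuffix S v → ¬ (∃[ k ] S ≡ 0F ∷ ones (suc k)) →
               (MAW S △ MAW (S ∷ʳ 0F)) ⊆ (_∈ candidates S v)
△⊆candidates S sas generic w∈△ with △-origin S sas w∈△
... | inj₁ refl                          = here refl
... | inj₂ (inj₁ (0F , refl , _))        = there (here refl)
... | inj₂ (inj₁ (1F , refl , _))        = there (there (here refl))
... | inj₂ (inj₂ (_ , inj₁ w∈))          = there (there (there w∈))
... | inj₂ (inj₂ (_ , inj₂ special))     = contradiction special generic

length-candidates : ∀ S v → length (candidates S v) ≡ 3 ⊔ length S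
length-candidates S v = trans (cong (3 +_) (length-flippedSuffixes (drop 2 S))) (go S)
  where
  go : ∀ S → 3 + (length (drop 2 S) ∸ 1) ≡ 3 ⊔ length S
  -- Truncated subtraction leaves no flipped suffix when |S| ≤ 3 and |S| - 3 of them otherwise,
  -- whence the maximum.
  go []              = refl
  go (_ ∷ [])        = refl
  go (_ ∷ _ ∷ [])    = refl
  go (_ ∷ _ ∷ _ ∷ _) = refl

-- The strings 01...1

0∷-occurs-ones0 : ∀ n → (0F ∷ v) OccursIn (ones n ∷ʳ 0F) → v ≡ []
0∷-occurs-ones0 zero    (here (refl ∷ [])) = refl
0∷-occurs-ones0 zero    (there (here ()))
0∷-occurs-ones0 (suc n) (here (() ∷ _))
0∷-occurs-ones0 (suc n) (there p)          = 0∷-occurs-ones0 n p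

0∉ones : ∀ n → ¬ (0F ∷ []) OccursIn ones n
0∉ones zero    (here ())
0∉ones (suc n) (here (() ∷ _))
0∉ones (suc n) (there p) = 0∉ones n p

-- The only 0 of 01...1 is its first letter, so no 0 comes after a 1.
1u0∉01 : ∀ u n → ¬ (1F ∷ u ∷ʳ 0F) OccursIn (0F ∷ ones n)
1u0∉01 u n (here (() ∷ _))
1u0∉01 u n (there p) = 0∉ones n (occurs-trans ((1F ∷ u) ++ⁱ occurs-refl) p)

ones0-prefix : ∀ m n → Prefix _≡_ (ones m ∷ʳ 0F) (ones n ∷ʳ 0F) → m ≡ n
ones0-prefix zero    zero    p          = refl
ones0-prefix zero    (suc n) (() ∷ _)
ones0-prefix (suc m) zero    (() ∷ _)
ones0-prefix (suc m) (suc n) (_ ∷ p)    = cong suc (ones0-prefix m n p)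

ones-prefix : ∀ {m n} → m ≤ n → Prefix _≡_ (ones m) (ones n)
ones-prefix z≤n       = []
ones-prefix (s≤s m≤n) = refl ∷ ones-prefix m≤n

ones-suffix : ∀ {m n} → m ≤ n → ones m SuffixOf ones n
ones-suffix {n = zero}  z≤n = here []
ones-suffix {n = suc n} m≤n with m≤n⇒m<n∨m≡n m≤n
... | inj₁ (s≤s m≤n′) = there (ones-suffix m≤n′)
... | inj₂ refl       = here (≡⇒Pointwise-≡ refl)

ones0-occurs : ∀ {m n} → m ≤ n → (ones m ∷ʳ 0F) OccursIn (0F ∷ ones n ∷ʳ 0F)
ones0-occurs m≤n = there (Infix.fromSuffix (suffix-∷ʳ⁺ (ones-suffix m≤n)))

-- This serves uniqueness: the head attains the bound, while the later entries obey the bound for a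
-- string one letter shorter.
flippedSuffixes-length-≤ : ∀ S → All (λ w → length w ≤ suc (length S)) (flippedSuffixes S)
flippedSuffixes-length-≤ []          = []
flippedSuffixes-length-≤ (_ ∷ [])    = []
flippedSuffixes-length-≤ (x ∷ y ∷ S) =
  s≤s (s≤s (≤-reflexive (length-∷ʳ S 0F))) ∷
  All.map (λ le → ≤-trans le (n≤1+n _)) (flippedSuffixes-length-≤ (y ∷ S))

flippedSuffixes-unique : ∀ S → Unique (flippedSuffixes S)
flippedSuffixes-unique []          = []
flippedSuffixes-unique (_ ∷ [])    = []
flippedSuffixes-unique (x ∷ y ∷ S) =
  All.map (λ { le refl → <-irrefl refl (subst (λ n → 2 + n ≤ 2 + length S) (length-∷ʳ S 0F) le) })
    (flippedSuffixes-length-≤ (y ∷ S)) ∷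
  flippedSuffixes-unique (y ∷ S)

flippedSuffixes-ones : ∀ n → All (λ w → ∃[ v ] w ≡ 0F ∷ v) (flippedSuffixes (ones n))
flippedSuffixes-ones zero          = []
flippedSuffixes-ones (suc zero)    = []
flippedSuffixes-ones (suc (suc n)) = (_ , refl) ∷ flippedSuffixes-ones (suc n)

module _ (k : ℕ) where

  private
    S₀ T₀ : String₂
    S₀ = 0F ∷ ones (suc k)
    T₀ = S₀ ∷ʳ 0F

  -- With v = 10 these are v, v1 and the words 01ʲ0 for 1 ≤ j ≤ k. Leaving out v0 makes up for the
  -- additional word 01ᵏ0.
  candidates-01ᵏ : List String₂
  candidates-01ᵏ = (1F ∷ 0F ∷ []) ∷ (1F ∷ 0F ∷ 1F ∷ []) ∷ flippedSuffixes (ones (suc k))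

  10-shortestAbsentSuffix : ShortestAbsentSuffix S₀ (1F ∷ 0F ∷ [])
  10-shortestAbsentSuffix =
    there (suffix-∷ʳ⁺ (ones-suffix {1} (s≤s z≤n))) , 1u0∉01 [] (suc k) , here (refl ∷ [])

  △⊆candidates-01ᵏ : (MAW S₀ △ MAW T₀) ⊆ (_∈ candidates-01ᵏ)
  △⊆candidates-01ᵏ w∈△ with △-origin S₀ 10-shortestAbsentSuffix w∈△
  ... | inj₁ refl                       = here refl
  ... | inj₂ (inj₁ (1F , refl , _))     = there (here refl)
  ... | inj₂ (inj₂ (w∈ , _))            = there (there w∈)
  -- The suffix 00 of 100 would have to occur in `T₀`, whose two 0s are separated by 1s.
  ... | inj₂ (inj₁ (0F , refl , mawT))  with proj₂ (proj₂ (MAW⁻ (0F ∷ []) mawT))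
  ...   | here (_ ∷ () ∷ _)
  ...   | there p = contradiction (0∷-occurs-ones0 (suc k) p) λ ()

  -- Appending 0 makes 10 occur, so 10 is lost and 101 is gained. Each 01ʲ0 is gained because 1ʲ0
  -- occurs in `T₀` but not in `S₀`.
  candidates-01ᵏ⊆△ : All (MAW S₀ △ MAW T₀) candidates-01ᵏ
  candidates-01ᵏ⊆△ =
    inj₁ (MAW⁺ [] (1u0∉01 [] (suc k)) (there (here (refl ∷ []))) (here (refl ∷ [])) ,
          λ mawT → proj₁ (proj₂ mawT) (ones0-occurs {1} (s≤s z≤n))) ∷
    inj₂ (MAW⁺ (0F ∷ []) 101∉T (ones0-occurs {1} (s≤s z≤n)) (here (refl ∷ refl ∷ [])) ,
          λ mawS → 1u0∉01 [] (suc k) (proj₁ (proj₂ (MAW⁻ (0F ∷ []) mawS)))) ∷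
    flipped k ≤-refl
    where
    101∉T : ¬ (1F ∷ 0F ∷ 1F ∷ []) OccursIn T₀
    101∉T (here (() ∷ _))
    101∉T (there p) =
      contradiction (0∷-occurs-ones0 (suc k) (occurs-trans (there occurs-refl) p)) λ ()

    flipped : ∀ j → j ≤ k → All (MAW S₀ △ MAW T₀) (flippedSuffixes (ones (suc j)))
    flipped zero    j≤k = []
    flipped (suc j) j<k =
      inj₂ (MAW⁺ (ones (suc j)) w∉T
              (here (refl ∷ ones-prefix (≤-trans j<k (n≤1+n k))) ⁱ++ (0F ∷ []))
              (ones0-occurs (≤-trans j<k (n≤1+n k))) ,
            λ mawS → 1u0∉01 (ones j) (suc k) (proj₂ (proj₂ (MAW⁻ (ones (suc j)) mawS)))) ∷
      flipped j (≤-trans (n≤1+n j) j<k)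
      where
      -- A match at the first 0 of `T₀` would force j = k; the other 0 is the last letter.
      w∉T : ¬ (0F ∷ ones (suc j) ∷ʳ 0F) OccursIn T₀
      w∉T (here (_ ∷ p)) with refl ← ones0-prefix (suc j) (suc k) p = <-irrefl refl j<k
      w∉T (there p)      = contradiction (0∷-occurs-ones0 (suc k) p) λ ()

  candidates-01ᵏ-unique : Unique candidates-01ᵏ
  candidates-01ᵏ-unique =
    ((λ ()) ∷ All.map (λ { (_ , refl) () }) (flippedSuffixes-ones (suc k))) ∷
    All.map (λ { (_ , refl) () }) (flippedSuffixes-ones (suc k)) ∷
    flippedSuffixes-unique (ones (suc k))

  length-candidates-01ᵏ : length candidates-01ᵏ ≡ 2 + k
  length-candidates-01ᵏ =
    cong (2 +_) (trans (length-flippedSuffixes (ones (suc k))) (length-replicate k))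

-- Cardinality bound and tightness

-- A covering list may repeat words or contain words outside `P`; deduplicating and filtering make
-- it exact without lengthening it.
finite : ∀ {P : String₂ → Set} → Decidable P → ∀ xs → P ⊆ (_∈ xs) →
         ∃[ n ] HasCardinality P n × n ≤ length xs
finite P? xs P⊆xs =
  _ ,
  (ys , filter⁺ P? (deduplicate-! _≟_ xs) ,
   ((λ p → ∈-filter⁺ P? (∈-deduplicate⁺ _≟_ (P⊆xs p)) p) ,
    proj₂ ∘ ∈-filter⁻ P? {xs = deduplicate _≟_ xs}) , refl) ,
  ≤-trans (length-filter P? (deduplicate _≟_ xs)) (length-deduplicate _≟_ xs)
  where
  _≟_ = ≡-dec _≟ᶠ_
  ys  = filter P? (deduplicate _≟_ xs)

hasCardinality : ∀ {P : String₂ → Set} {xs} → Unique xs → P ⊆ (_∈ xs) → All P xs →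
                 HasCardinality P (length xs)
hasCardinality unique P⊆xs all = _ , unique , (P⊆xs , All.lookup all) , refl

-- The length of S leaves only k = |S| - 2, so one comparison decides.
special? : ∀ S → Dec (∃[ k ] S ≡ 0F ∷ ones (suc k))
special? S = map′ (_ ,_) (λ { (k , refl) → cong (λ n → 0F ∷ ones (suc n)) (sym (length-replicate k)) })
               (≡-dec _≟ᶠ_ S (0F ∷ ones (suc (length S ∸ 2))))

cardinality-bound : ∀ S → ∃[ n ] HasCardinality (MAW S △ MAW (S ∷ʳ 0F)) n × n ≤ 3 ⊔ length S
cardinality-bound S with special? S
... | no generic
  with v , sas ← ∃-shortestAbsentSuffix S
  with n , card , n≤ ← finite (△? S (S ∷ʳ 0F)) (candidates S v) (△⊆candidates S sas generic) =
  n , card , ≤-trans n≤ (≤-reflexive (length-candidates S v))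
... | yes (k , refl)
  with n , card , n≤ ← finite (△? S (S ∷ʳ 0F)) (candidates-01ᵏ k) (△⊆candidates-01ᵏ k) =
  n , card , (begin
    n                                ≤⟨ n≤ ⟩
    length (candidates-01ᵏ k)        ≡⟨ length-candidates-01ᵏ k ⟩
    2 + k                            ≡⟨ cong (2 +_) (length-replicate k) ⟨
    length S                         ≤⟨ m≤n⊔m 3 (length S) ⟩
    3 ⊔ length S                     ∎)
  where open ≤-Reasoning

short-unique : Unique {A = String₂} ((0F ∷ []) ∷ (0F ∷ 0F ∷ []) ∷ (0F ∷ 1F ∷ []) ∷ [])
short-unique = ((λ ()) ∷ (λ ()) ∷ []) ∷ ((λ ()) ∷ []) ∷ [] ∷ []

-- The string 01 gives only two words, so 1 and 11 serve for d ≤ 2: their shortest absent suffix is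
-- 0, and evaluating the decision procedure confirms the candidates 0, 00 and 01.
attained : ∀ d → 1 ≤ d → ∃[ S ] length S ≡ d × HasCardinality (MAW S △ MAW (S ∷ʳ 0F)) (3 ⊔ d)
attained 1 _ =
  ones 1 , refl ,
  hasCardinality short-unique
    (△⊆candidates (ones 1) (there (here (refl ∷ [])) , 0∉ones 1 , here []) λ { (_ , ()) })
    (toWitness {a? = All.all? (△? (ones 1) (ones 1 ∷ʳ 0F)) (candidates (ones 1) (0F ∷ []))} _)
attained 2 _ =
  ones 2 , refl ,
  hasCardinality short-unique
    (△⊆candidates (ones 2) (there (there (here (refl ∷ []))) , 0∉ones 2 , here []) λ { (_ , ()) })
    (toWitness {a? = All.all? (△? (ones 2) (ones 2 ∷ʳ 0F)) (candidates (ones 2) (0F ∷ []))} _)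
attained (suc (suc (suc k))) _ =
  0F ∷ ones (2 + k) , cong (3 +_) (length-replicate k) ,
  subst (HasCardinality _) (length-candidates-01ᵏ (suc k))
    (hasCardinality (candidates-01ᵏ-unique (suc k)) (△⊆candidates-01ᵏ (suc k))
      (candidates-01ᵏ⊆△ (suc k)))

corollary4 : ∀ (d : ℕ) → 1 ≤ d →
    (∀ (S : String₂) → length S ≡ d →
    ∃[ n ] HasCardinality (MAW S △ MAW (S ∷ʳ 0F)) n × n ≤ 3 ⊔ d)
    ×
    (∃[ S ] length S ≡ d × HasCardinality (MAW S △ MAW (S ∷ʳ 0F)) (3 ⊔ d))
corollary4 d 1≤d = (λ { S refl → cardinality-bound S }) , attained d 1≤d
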